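{- Let $(x_k)_{k\ge0}$ be indeterminates, define $a_n=x_n$ if $n=2^k-1$ for some integer $k\ge0$ and $a_n=0$ otherwise, let $D(n)=\det\left(a_{i+j+1}\right)_{i,j=0}^{n-1}$ with $D(0)=1$, and let $T_n=\frac{D(n)D(n+2)}{D(n+1)^2}$ (in the field of rational functions). Then for all integers $k\ge1$, $n\ge0$ and $j\in\{0,1\}$, $$T_{2^{k+1}n+2^k-2+j}=(-1)^nT_{2^k-2+j}.$$
   Context: Each $D(n)$ is a nonzero polynomial, so $T_n$ is well defined. -}

module Defs where

open import Algebra.Bundles using (CommutativeRing)
import Algebra.Properties.Semiring.Exp as Exp
import Algebra.Properties.Semiring.Sum as Sum
open import Data.Bool.Base using (Bool; true; false; _∧_; _xor_; if_then_else_)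
open import Data.Bool.Properties using (∧-assoc; ∧-comm; ∧-zeroʳ; xor-∧-commutativeRing)
open import Data.Fin.Base as Fin using (Fin; toℕ; punchIn)
open import Data.List.Base using (List; []; _∷_; _++_; length; tabulate)
open import Data.List.Properties using (length-++; tabulate-cong; ++-assoc)
open import Data.List.Relation.Binary.Permutation.Propositional
  using (_↭_; ↭-refl; ↭-sym; refl; prep; swap; trans)
open import Data.List.Relation.Binary.Permutation.Propositional.Properties
  using (All-resp-↭; ↭-length; ++-comm; ++⁺ˡ)
open import Data.List.Relation.Unary.All as All using (All; []; _∷_)
open import Data.List.Relation.Unary.All.Properties using (++⁺)
open import Data.Nat.Base using (ℕ; zero; suc; pred; _+_; _*_; _∸_; _^_; _≤_; _<_; z≤n; s≤s;
  s≤s⁻¹)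
open import Data.Nat.Induction using (<-rec)
open import Data.Nat.Properties as ℕₚ using (anyUpTo?)
open import Data.Nat.Solver using (module +-*-Solver)
open import Data.Product.Base using (∃; _×_; _,_)
open import Function.Base using (_∘_)
open import Level using (0ℓ; _⊔_)
open import Relation.Binary.PropositionalEquality as ≡
  using (_≡_; refl; cong; cong₂; subst; module ≡-Reasoning)
open import Relation.Nullary.Decidable using (Dec; does; yes; no; map′; dec-true; dec-false)
open import Relation.Nullary.Negation using (¬_)

module _ {c ℓ} (R : CommutativeRing c ℓ) where
  open CommutativeRing R using (Carrier; _≈_; 0#; 1#; -_; semiring)
    renaming (_*_ to _*ᴿ_)
  open Sum semiring using (sum)
  open Exp semiring using () renaming (_^_ to _^ᴿ_)

  -- Cofactor expansion along the first row.
  det : ∀ n → (Fin n → Fin n → Carrier) → Carrier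
  det zero    M = 1#
  det (suc n) M = sum λ j →
    (- 1#) ^ᴿ toℕ j *ᴿ (M Fin.zero j *ᴿ det n λ i k → M (Fin.suc i) (punchIn j k))

  -- Elements of the field of fractions of an integral domain R.
  record Fraction : Set (c ⊔ ℓ) where
    constructor _/_[_]
    field
      num   : Carrier
      den   : Carrier
      den≉0 : ¬ den ≈ 0#

module _ {c ℓ} {R : CommutativeRing c ℓ} where
  open CommutativeRing R using (Carrier; _≈_) renaming (_*_ to _*ᴿ_)
  open Fraction

  infix  4 _≃_
  infixr 7 _·_

  _≃_ : Fraction R → Fraction R → Set ℓ
  p ≃ q = num p *ᴿ den q ≈ num q *ᴿ den p

  _·_ : Carrier → Fraction R → Fraction R
  r · p = (r *ᴿ num p) / den p [ den≉0 p ]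

-- The polynomial ring ℤ[x₀, x₁, x₂, …], presented as the free commutative ring
-- on the indeterminates: ring expressions, equated exactly when the
-- commutative ring axioms force them to be equal.
infixl 6 _+ₚ_
infixl 7 _*ₚ_
infix  8 -ₚ_
infix  4 _≈ₚ_

data Polynomial : Set where
  x    : ℕ → Polynomial
  0ₚ   : Polynomial
  1ₚ   : Polynomial
  _+ₚ_ : Polynomial → Polynomial → Polynomial
  _*ₚ_ : Polynomial → Polynomial → Polynomial
  -ₚ_  : Polynomial → Polynomial

data _≈ₚ_ : Polynomial → Polynomial → Set where
  ≈-refl       : ∀ {p} → p ≈ₚ p
  ≈-sym        : ∀ {p q} → p ≈ₚ q → q ≈ₚ p
  ≈-trans      : ∀ {p q r} → p ≈ₚ q → q ≈ₚ r → p ≈ₚ r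
  +-cong       : ∀ {p p′ q q′} → p ≈ₚ p′ → q ≈ₚ q′ → p +ₚ q ≈ₚ p′ +ₚ q′
  *-cong       : ∀ {p p′ q q′} → p ≈ₚ p′ → q ≈ₚ q′ → p *ₚ q ≈ₚ p′ *ₚ q′
  -‿cong       : ∀ {p p′} → p ≈ₚ p′ → -ₚ p ≈ₚ -ₚ p′
  +-assoc      : ∀ p q r → (p +ₚ q) +ₚ r ≈ₚ p +ₚ (q +ₚ r)
  +-comm       : ∀ p q → p +ₚ q ≈ₚ q +ₚ p
  +-identityˡ  : ∀ p → 0ₚ +ₚ p ≈ₚ p
  -‿inverseˡ   : ∀ p → -ₚ p +ₚ p ≈ₚ 0ₚ
  *-assoc      : ∀ p q r → (p *ₚ q) *ₚ r ≈ₚ p *ₚ (q *ₚ r)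
  *-comm       : ∀ p q → p *ₚ q ≈ₚ q *ₚ p
  *-identityˡ  : ∀ p → 1ₚ *ₚ p ≈ₚ p
  *-distribʳ-+ : ∀ p q r → (q +ₚ r) *ₚ p ≈ₚ q *ₚ p +ₚ r *ₚ p

ℤ[x] : CommutativeRing 0ℓ 0ℓ
ℤ[x] = record
  { Carrier = Polynomial
  ; _≈_ = _≈ₚ_
  ; _+_ = _+ₚ_
  ; _*_ = _*ₚ_
  ; -_  = -ₚ_
  ; 0#  = 0ₚ
  ; 1#  = 1ₚ
  ; isCommutativeRing = record
    { isRing = record
      { +-isAbelianGroup = record
        { isGroup = record
          { isMonoid = record
            { isSemigroup = record
              { isMagma = record
                { isEquivalence = record
                  { refl = ≈-refl ; sym = ≈-sym ; trans = ≈-trans }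
                ; ∙-cong = +-cong
                }
              ; assoc = +-assoc
              }
            ; identity = +-identityˡ , λ p → ≈-trans (+-comm p 0ₚ) (+-identityˡ p)
            }
          ; inverse = -‿inverseˡ , λ p → ≈-trans (+-comm p (-ₚ p)) (-‿inverseˡ p)
          ; ⁻¹-cong = -‿cong
          }
        ; comm = +-comm
        }
      ; *-cong = *-cong
      ; *-assoc = *-assoc
      ; *-identity = *-identityˡ , λ p → ≈-trans (*-comm p 1ₚ) (*-identityˡ p)
      ; distrib =
          (λ p q r → ≈-trans (*-comm p (q +ₚ r))
            (≈-trans (*-distribʳ-+ p q r) (+-cong (*-comm q p) (*-comm r p))))
        , *-distribʳ-+
      }
    ; *-comm = *-comm
    }
  }

open Exp (CommutativeRing.semiring ℤ[x]) public
  using () renaming (_^_ to _^ₚ_)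

n<2^n : ∀ n → n < 2 ^ n
n<2^n zero    = s≤s z≤n
n<2^n (suc n) = ℕₚ.≤-trans (s≤s (n<2^n n))
  (ℕₚ.≤-trans (ℕₚ.+-monoˡ-≤ (2 ^ n) (ℕₚ.m^n>0 2 n))
    (ℕₚ.≤-reflexive (cong (2 ^ n +_) (≡.sym (ℕₚ.+-identityʳ (2 ^ n))))))

mersenne? : ∀ n → Dec (∃ λ k → n ≡ 2 ^ k ∸ 1)
mersenne? n = map′ (λ (k , _ , eq) → k , eq)
  (λ (k , eq) → k , s≤s (subst (k ≤_) (≡.sym eq) (ℕₚ.∸-monoˡ-≤ 1 (n<2^n k))) , eq)
  (anyUpTo? (λ k → n ℕₚ.≟ (2 ^ k ∸ 1)) (suc n))

a : ℕ → Polynomial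
a n = if does (mersenne? n) then x n else 0ₚ

D : ℕ → Polynomial
D n = det ℤ[x] n λ i j → a (toℕ i + toℕ j + 1)

-- D n is nonzero: substituting 1 for every indeterminate gives an odd number.
module NonVanishing where

  ⟦_⟧ : Polynomial → Bool
  ⟦ x _ ⟧    = true
  ⟦ 0ₚ ⟧     = false
  ⟦ 1ₚ ⟧     = true
  ⟦ p +ₚ q ⟧ = ⟦ p ⟧ xor ⟦ q ⟧
  ⟦ p *ₚ q ⟧ = ⟦ p ⟧ ∧ ⟦ q ⟧
  ⟦ -ₚ p ⟧   = ⟦ p ⟧

  module 𝔽₂ = CommutativeRing xor-∧-commutativeRing

  ⟦⟧-cong : ∀ {p q} → p ≈ₚ q → ⟦ p ⟧ ≡ ⟦ q ⟧
  ⟦⟧-cong ≈-refl               = refl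
  ⟦⟧-cong (≈-sym e)            = ≡.sym (⟦⟧-cong e)
  ⟦⟧-cong (≈-trans e f)        = ≡.trans (⟦⟧-cong e) (⟦⟧-cong f)
  ⟦⟧-cong (+-cong e f)         = cong₂ _xor_ (⟦⟧-cong e) (⟦⟧-cong f)
  ⟦⟧-cong (*-cong e f)         = cong₂ _∧_ (⟦⟧-cong e) (⟦⟧-cong f)
  ⟦⟧-cong (-‿cong e)           = ⟦⟧-cong e
  ⟦⟧-cong (+-assoc p q r)      = 𝔽₂.+-assoc ⟦ p ⟧ ⟦ q ⟧ ⟦ r ⟧
  ⟦⟧-cong (+-comm p q)         = 𝔽₂.+-comm ⟦ p ⟧ ⟦ q ⟧
  ⟦⟧-cong (+-identityˡ p)      = refl
  ⟦⟧-cong (-‿inverseˡ p)       = 𝔽₂.-‿inverseˡ ⟦ p ⟧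
  ⟦⟧-cong (*-assoc p q r)      = ∧-assoc ⟦ p ⟧ ⟦ q ⟧ ⟦ r ⟧
  ⟦⟧-cong (*-comm p q)         = ∧-comm ⟦ p ⟧ ⟦ q ⟧
  ⟦⟧-cong (*-identityˡ p)      = refl
  ⟦⟧-cong (*-distribʳ-+ p q r) = 𝔽₂.distribʳ ⟦ p ⟧ ⟦ q ⟧ ⟦ r ⟧

  -- Sum over all ways to select one entry of a list, f receiving the entry
  -- and the list of the remaining ones.
  select : (ℕ → List ℕ → Bool) → List ℕ → Bool
  select f []       = false
  select f (c ∷ cs) = f c cs xor select (λ d ds → f d (c ∷ ds)) cs

  select-cong : ∀ {f g} cs → (∀ c ds → c ∷ ds ↭ cs → f c ds ≡ g c ds) →
                select f cs ≡ select g cs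
  select-cong []       e = refl
  select-cong (c ∷ cs) e = cong₂ _xor_ (e c cs ↭-refl)
    (select-cong cs λ d ds s → e d (c ∷ ds) (trans (swap d c ↭-refl) (prep c s)))

  select-0 : ∀ {f} cs → (∀ c ds → c ∷ ds ↭ cs → f c ds ≡ false) → select f cs ≡ false
  select-0 cs e = ≡.trans (select-cong cs e) (const cs)
    where
    const : ∀ cs → select (λ _ _ → false) cs ≡ false
    const []       = refl
    const (_ ∷ cs) = const cs

  select-∧ : ∀ f b cs → select (λ c ds → f c ds ∧ b) cs ≡ select f cs ∧ b
  select-∧ f b []       = refl
  select-∧ f b (c ∷ cs) = ≡.trans
    (cong ((f c cs ∧ b) xor_) (select-∧ (λ d ds → f d (c ∷ ds)) b cs))
    (≡.sym (𝔽₂.distribʳ b (f c cs) _))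

  select-++ : ∀ f cs ds → select f (cs ++ ds) ≡
    select (λ c cs′ → f c (cs′ ++ ds)) cs xor select (λ d ds′ → f d (cs ++ ds′)) ds
  select-++ f []       ds = refl
  select-++ f (c ∷ cs) ds = ≡.trans
    (cong (f c (cs ++ ds) xor_) (select-++ (λ d ds′ → f d (c ∷ ds′)) cs ds))
    (≡.sym (𝔽₂.+-assoc (f c (cs ++ ds)) _ _))

  select-↭ : ∀ {f cs ds} → (∀ c {es fs} → es ↭ fs → f c es ≡ f c fs) →
             cs ↭ ds → select f cs ≡ select f ds
  select-↭ e refl        = refl
  select-↭ e (prep c s)  = cong₂ _xor_ (e c s) (select-↭ (λ d t → e d (prep c t)) s)
  select-↭ {f} e (swap {xs = cs} {ys = ds} c d s) = begin
    f c (d ∷ cs) xor (f d (c ∷ cs) xor S)  ≡⟨ 𝔽₂.+-assoc (f c (d ∷ cs)) _ _ ⟨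
    (f c (d ∷ cs) xor f d (c ∷ cs)) xor S  ≡⟨ cong₂ _xor_ heads tails ⟩
    (f d (c ∷ ds) xor f c (d ∷ ds)) xor S′ ≡⟨ 𝔽₂.+-assoc (f d (c ∷ ds)) _ _ ⟩
    f d (c ∷ ds) xor (f c (d ∷ ds) xor S′) ∎
    where
    open ≡-Reasoning
    S  = select (λ b bs → f b (c ∷ d ∷ bs)) cs
    S′ = select (λ b bs → f b (d ∷ c ∷ bs)) ds
    heads : f c (d ∷ cs) xor f d (c ∷ cs) ≡ f d (c ∷ ds) xor f c (d ∷ ds)
    heads = ≡.trans (𝔽₂.+-comm (f c (d ∷ cs)) _)
      (cong₂ _xor_ (e d (prep c s)) (e c (prep d s)))
    tails : S ≡ S′
    tails = ≡.trans (select-cong cs λ b bs _ → e b (swap c d ↭-refl))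
      (select-↭ (λ b t → e b (prep d (prep c t))) s)
  select-↭ e (trans s t) = ≡.trans (select-↭ e s) (select-↭ e t)

  h : ℕ → ℕ → Bool
  h r c = does (mersenne? (r + c + 1))

  -- The determinant mod 2 of the submatrix with the given rows and columns.
  det₂ : List ℕ → List ℕ → Bool
  det₂ []       _  = true
  det₂ (r ∷ rs) cs = select (λ c ds → h r c ∧ det₂ rs ds) cs

  det₂-↭ : ∀ rs {cs ds} → cs ↭ ds → det₂ rs cs ≡ det₂ rs ds
  det₂-↭ []       s = refl
  det₂-↭ (r ∷ rs) s = select-↭ (λ c t → cong (h r c ∧_) (det₂-↭ rs t)) s

  Vanish : List ℕ → List ℕ → Set
  Vanish rs cs = All (λ r → All (λ c → h r c ≡ false) cs) rs

  xor-cong₀ : ∀ {p q r} → p ≡ r → q ≡ false → p xor q ≡ r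
  xor-cong₀ {r = r} refl refl = 𝔽₂.+-identityʳ r

  -- Block triangular determinants, with the zero block in either corner.

  det₂-upper : ∀ rs rs′ cs ds → length rs ≡ length cs → Vanish rs ds →
               det₂ (rs ++ rs′) (cs ++ ds) ≡ det₂ rs cs ∧ det₂ rs′ ds
  det₂-upper []       rs′ []  ds l []      = refl
  det₂-upper (r ∷ rs) rs′ cs ds l (z ∷ zs) = ≡.trans (select-++ _ cs ds) (xor-cong₀
    (≡.trans (select-cong cs λ c es s → ≡.trans
        (cong (h r c ∧_) (det₂-upper rs rs′ es ds
          (ℕₚ.suc-injective (≡.trans l (≡.sym (↭-length s)))) zs))
        (≡.sym (∧-assoc (h r c) _ _)))
      (select-∧ _ (det₂ rs′ ds) cs))
    (select-0 ds λ d es s → cong (_∧ _) (All.head (All-resp-↭ (↭-sym s) z))))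

  det₂-rank : ∀ rs rs′ cs ds → length ds < length rs′ → Vanish rs′ cs →
              det₂ (rs ++ rs′) (cs ++ ds) ≡ false
  det₂-rank []       (r ∷ rs′) cs ds l (z ∷ zs) = ≡.trans (select-++ _ cs ds) (xor-cong₀
    (select-0 cs λ c es s → cong (_∧ _) (All.head (All-resp-↭ (↭-sym s) z)))
    (select-0 ds λ d es s → ≡.trans
      (cong (h r d ∧_) (det₂-rank [] rs′ cs es
        (s≤s⁻¹ (subst (_< _) (≡.sym (↭-length s)) l)) zs))
      (∧-zeroʳ (h r d))))
  det₂-rank (r ∷ rs) rs′ cs ds l z = ≡.trans (select-++ _ cs ds) (xor-cong₀
    (select-0 cs λ c es s → ≡.trans
      (cong (h r c ∧_) (det₂-rank rs rs′ es ds l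
        (All.map (λ w → All.tail (All-resp-↭ (↭-sym s) w)) z)))
      (∧-zeroʳ (h r c)))
    (select-0 ds λ d es s → ≡.trans
      (cong (h r d ∧_) (det₂-rank rs rs′ cs es
        (ℕₚ.<-trans (ℕₚ.≤-reflexive (↭-length s)) l) z))
      (∧-zeroʳ (h r d))))

  det₂-lower : ∀ rs rs′ cs ds → length rs ≡ length cs → length rs′ ≡ length ds →
               Vanish rs′ cs → det₂ (rs ++ rs′) (cs ++ ds) ≡ det₂ rs cs ∧ det₂ rs′ ds
  det₂-lower []       rs′ []  ds l l′ z = refl
  det₂-lower (r ∷ rs) rs′ cs ds l l′ z = ≡.trans (select-++ _ cs ds) (xor-cong₀
    (≡.trans (select-cong cs λ c es s → ≡.trans
        (cong (h r c ∧_) (det₂-lower rs rs′ es ds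
          (ℕₚ.suc-injective (≡.trans l (≡.sym (↭-length s)))) l′
          (All.map (λ w → All.tail (All-resp-↭ (↭-sym s) w)) z)))
        (≡.sym (∧-assoc (h r c) _ _)))
      (select-∧ _ (det₂ rs′ ds) cs))
    (select-0 ds λ d es s → ≡.trans
      (cong (h r d ∧_) (det₂-rank rs rs′ cs es
        (ℕₚ.≤-reflexive (≡.trans (↭-length s) (≡.sym l′))) z))
      (∧-zeroʳ (h r d))))

  segment : ℕ → ℕ → List ℕ
  segment s zero    = []
  segment s (suc l) = s ∷ segment (suc s) l

  length-segment : ∀ s l → length (segment s l) ≡ l
  length-segment s zero    = refl
  length-segment s (suc l) = cong suc (length-segment (suc s) l)

  segment-++ : ∀ s k l → segment s (k + l) ≡ segment s k ++ segment (s + k) l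
  segment-++ s zero    l = cong (λ t → segment t l) (≡.sym (ℕₚ.+-identityʳ s))
  segment-++ s (suc k) l = cong (s ∷_) (≡.trans (segment-++ (suc s) k l)
    (cong (λ t → segment (suc s) k ++ segment t l) (≡.sym (ℕₚ.+-suc s k))))

  segment-All : ∀ {P : ℕ → Set} s l → (∀ i → s ≤ i → i < s + l → P i) → All P (segment s l)
  segment-All s zero    p = []
  segment-All s (suc l) p = p s ℕₚ.≤-refl (ℕₚ.m<m+n s (s≤s z≤n)) ∷
    segment-All (suc s) l λ i s<i i<s+l → p i (ℕₚ.<⇒≤ s<i)
      (ℕₚ.<-≤-trans i<s+l (ℕₚ.≤-reflexive (≡.sym (ℕₚ.+-suc s l))))

  h-true : ∀ e r c → r + c + 2 ≡ 2 ^ e → h r c ≡ true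
  h-true e r c eq = dec-true (mersenne? (r + c + 1))
    (e , cong pred (≡.trans (≡.sym (ℕₚ.+-suc (r + c) 1)) eq))

  h-false : ∀ e r c → 2 ^ e < r + c + 2 → r + c + 2 < 2 ^ suc e → h r c ≡ false
  h-false e r c lo hi = dec-false (mersenne? (r + c + 1)) λ (k , eq) → absurd k
    (≡.trans (ℕₚ.+-suc (r + c) 1)
      (≡.trans (cong suc eq) (ℕₚ.suc-pred (2 ^ k) ⦃ ℕₚ.m^n≢0 2 k ⦄)))
    where
    absurd : ∀ k → ¬ (r + c + 2 ≡ 2 ^ k)
    absurd k eq with k ℕₚ.≤? e
    ... | yes k≤e = ℕₚ.<-irrefl (≡.sym eq) (ℕₚ.≤-<-trans (ℕₚ.^-monoʳ-≤ 2 k≤e) lo)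
    ... | no  k≰e = ℕₚ.<-irrefl eq (ℕₚ.<-≤-trans hi (ℕₚ.^-monoʳ-≤ 2 (ℕₚ.≰⇒> k≰e)))

  vanish : ∀ e s k t l → 2 ^ e < s + t + 2 → s + k + (t + l) < 2 ^ suc e →
           Vanish (segment s k) (segment t l)
  vanish e s k t l lo hi = segment-All s k λ i s≤i i<s+k → segment-All t l λ j t≤j j<t+l →
    h-false e i j (ℕₚ.<-≤-trans lo (ℕₚ.+-monoˡ-≤ 2 (ℕₚ.+-mono-≤ s≤i t≤j)))
      (ℕₚ.≤-<-trans (ℕₚ.≤-reflexive (shift i j)) (ℕₚ.≤-<-trans (ℕₚ.+-mono-≤ i<s+k j<t+l) hi))
    where
    shift : ∀ i j → i + j + 2 ≡ suc i + suc j
    shift = solve 2 (λ i j → i :+ j :+ con 2 := con 1 :+ i :+ (con 1 :+ j)) refl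
      where open +-*-Solver

  -- Ones on the antidiagonal (entries summing to 2 ^ suc e ∸ 2), zeros above it.
  antidiagonal : ∀ e l s t → 2 ^ e < s + t + 2 → s + t + l + 1 ≡ 2 ^ suc e →
                 det₂ (segment s l) (segment t l) ≡ true
  antidiagonal e zero    s t lo eq = refl
  antidiagonal e (suc l) s t lo eq = begin
    det₂ (s ∷ rs) (segment t (suc l))
      ≡⟨ cong (det₂ (s ∷ rs)) (≡.trans (cong (segment t) (ℕₚ.+-comm 1 l)) (segment-++ t l 1)) ⟩
    det₂ (s ∷ rs) (segment t l ++ t + l ∷ [])
      ≡⟨ det₂-↭ (s ∷ rs) (++-comm (segment t l) (t + l ∷ [])) ⟩
    det₂ (s ∷ rs) (t + l ∷ segment t l)
      ≡⟨ det₂-upper (s ∷ []) rs (t + l ∷ []) (segment t l) refl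
           (vanish e s 1 t l lo (ℕₚ.≤-reflexive (≡.trans (eq₁ s t l) eq))) ⟩
    ((h s (t + l) ∧ true) xor false) ∧ det₂ rs (segment t l)
      ≡⟨ cong₂ (λ p q → ((p ∧ true) xor false) ∧ q)
           (h-true (suc e) s (t + l) (≡.trans (eq₂ s t l) eq))
           (antidiagonal e l (suc s) t (ℕₚ.m<n⇒m<1+n lo) (≡.trans (eq₃ s t l) eq)) ⟩
    true ∎
    where
    open ≡-Reasoning
    open +-*-Solver
    rs = segment (suc s) l
    eq₁ : ∀ s t l → suc (s + 1 + (t + l)) ≡ s + t + suc l + 1
    eq₁ = solve 3 (λ s t l → con 1 :+ (s :+ con 1 :+ (t :+ l)) :=
                             s :+ t :+ (con 1 :+ l) :+ con 1) refl
    eq₂ : ∀ s t l → s + (t + l) + 2 ≡ s + t + suc l + 1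
    eq₂ = solve 3 (λ s t l → s :+ (t :+ l) :+ con 2 := s :+ t :+ (con 1 :+ l) :+ con 1) refl
    eq₃ : ∀ s t l → suc s + t + l + 1 ≡ s + t + suc l + 1
    eq₃ = solve 3 (λ s t l → con 1 :+ s :+ t :+ l :+ con 1 :=
                             s :+ t :+ (con 1 :+ l) :+ con 1) refl

  hankel₂ : ℕ → Bool
  hankel₂ n = det₂ (segment 0 n) (segment 0 n)

  -- With 2 ^ e = r + u + 1 ≤ n = r + 2 u + 1 < 2 ^ suc e, the row segments of
  -- lengths r, u, u + 1 and column segments of lengths r, u + 1, u form the blocks
  --   H * 0
  --   * * J
  --   0 J 0
  -- with H the Hankel matrix of size r and J triangular about its antidiagonal.
  hankel₂-step : ∀ e r u → r + u + 1 ≡ 2 ^ e → hankel₂ r ≡ true →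
                 hankel₂ (r + u + (u + 1)) ≡ true
  hankel₂-step e r u eq ih = begin
    hankel₂ (r + u + (u + 1))
      ≡⟨ cong₂ det₂ rows cols ⟩
    det₂ ((R ++ C) ++ A) ((R ++ B) ++ E)
      ≡⟨ det₂-↭ ((R ++ C) ++ A) perm ⟩
    det₂ ((R ++ C) ++ A) ((R ++ E) ++ B)
      ≡⟨ det₂-lower (R ++ C) A (R ++ E) B
           (len₂ C E (≡.trans (length-segment r u) (≡.sym (length-segment (r + (u + 1)) u))))
           (≡.trans (length-segment (r + u) (u + 1)) (≡.sym (length-segment r (u + 1))))
           (vanish-++ A R E A-R A-E) ⟩
    det₂ (R ++ C) (R ++ E) ∧ det₂ A B
      ≡⟨ cong (_∧ det₂ A B) (det₂-upper R C R E refl R-E) ⟩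
    (hankel₂ r ∧ det₂ C E) ∧ det₂ A B
      ≡⟨ cong₂ _∧_ (cong₂ _∧_ ih C-E) A-B ⟩
    true ∎
    where
    open ≡-Reasoning
    R = segment 0 r
    C = segment r u
    A = segment (r + u) (u + 1)
    B = segment r (u + 1)
    E = segment (r + (u + 1)) u

    rows : segment 0 (r + u + (u + 1)) ≡ (R ++ C) ++ A
    rows = ≡.trans (segment-++ 0 (r + u) (u + 1)) (cong (_++ A) (segment-++ 0 r u))

    cols : segment 0 (r + u + (u + 1)) ≡ (R ++ B) ++ E
    cols = ≡.trans (cong (segment 0) (solve 2 (λ r u →
        r :+ u :+ (u :+ con 1) := r :+ (u :+ con 1) :+ u) refl r u))
      (≡.trans (segment-++ 0 (r + (u + 1)) u) (cong (_++ E) (segment-++ 0 r (u + 1))))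
      where open +-*-Solver

    perm : (R ++ B) ++ E ↭ (R ++ E) ++ B
    perm = subst (_↭ (R ++ E) ++ B) (≡.sym (++-assoc R B E))
      (subst (R ++ (B ++ E) ↭_) (≡.sym (++-assoc R E B)) (++⁺ˡ R (++-comm B E)))

    len₂ : ∀ (cs ds : List ℕ) → length cs ≡ length ds → length (R ++ cs) ≡ length (R ++ ds)
    len₂ cs ds l = ≡.trans (length-++ R) (≡.trans (cong (length R +_) l) (≡.sym (length-++ R)))

    vanish-++ : ∀ rs cs ds → Vanish rs cs → Vanish rs ds → Vanish rs (cs ++ ds)
    vanish-++ rs cs ds v w = All.zipWith (λ (p , q) → ++⁺ p q) (v , w)

    open +-*-Solver

    lower : ∀ {m n} k l → m ≡ k → n ≡ suc k + l → m < n
    lower k l refl refl = ℕₚ.m≤m+n (suc k) l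

    2^e+1 : 2 ^ suc e ≡ (r + u + 1) + (r + u + 1)
    2^e+1 = ≡.trans (cong (2 *_) (≡.sym eq)) (cong ((r + u + 1) +_) (ℕₚ.+-identityʳ (r + u + 1)))

    2^e+2 : 2 ^ suc (suc e) ≡ ((r + u + 1) + (r + u + 1)) + ((r + u + 1) + (r + u + 1))
    2^e+2 = ≡.trans (cong (2 *_) 2^e+1)
      (cong (((r + u + 1) + (r + u + 1)) +_) (ℕₚ.+-identityʳ _))

    A-R : Vanish A R
    A-R = vanish e (r + u) (u + 1) 0 r
      (lower (r + u + 1) 0 (≡.sym eq) (solve 2 (λ r u →
        r :+ u :+ con 0 :+ con 2 := con 1 :+ (r :+ u :+ con 1) :+ con 0) refl r u))
      (lower _ 0 refl (≡.trans 2^e+1 (solve 2 (λ r u →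
        (r :+ u :+ con 1) :+ (r :+ u :+ con 1) :=
        con 1 :+ (r :+ u :+ (u :+ con 1) :+ (con 0 :+ r)) :+ con 0) refl r u)))

    A-E : Vanish A E
    A-E = vanish (suc e) (r + u) (u + 1) (r + (u + 1)) u
      (lower _ 0 2^e+1 (solve 2 (λ r u →
        r :+ u :+ (r :+ (u :+ con 1)) :+ con 2 :=
        con 1 :+ ((r :+ u :+ con 1) :+ (r :+ u :+ con 1)) :+ con 0) refl r u))
      (lower _ (r + r + 1) refl (≡.trans 2^e+2 (solve 2 (λ r u →
        ((r :+ u :+ con 1) :+ (r :+ u :+ con 1)) :+ ((r :+ u :+ con 1) :+ (r :+ u :+ con 1)) :=
        con 1 :+ (r :+ u :+ (u :+ con 1) :+ (r :+ (u :+ con 1) :+ u)) :+ (r :+ r :+ con 1))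
        refl r u)))

    R-E : Vanish R E
    R-E = vanish e 0 r (r + (u + 1)) u
      (lower _ 1 (≡.sym eq) (solve 2 (λ r u →
        con 0 :+ (r :+ (u :+ con 1)) :+ con 2 := con 1 :+ (r :+ u :+ con 1) :+ con 1) refl r u))
      (lower _ 0 refl (≡.trans 2^e+1 (solve 2 (λ r u →
        (r :+ u :+ con 1) :+ (r :+ u :+ con 1) :=
        con 1 :+ (con 0 :+ r :+ (r :+ (u :+ con 1) :+ u)) :+ con 0) refl r u)))

    C-E : det₂ C E ≡ true
    C-E = antidiagonal e u r (r + (u + 1))
      (lower _ (r + 1) (≡.sym eq) (solve 2 (λ r u →
        r :+ (r :+ (u :+ con 1)) :+ con 2 := con 1 :+ (r :+ u :+ con 1) :+ (r :+ con 1)) refl r u))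
      (≡.sym (≡.trans 2^e+1 (solve 2 (λ r u →
        (r :+ u :+ con 1) :+ (r :+ u :+ con 1) :=
        r :+ (r :+ (u :+ con 1)) :+ u :+ con 1) refl r u)))

    A-B : det₂ A B ≡ true
    A-B = antidiagonal e (u + 1) (r + u) r
      (lower _ r (≡.sym eq) (solve 2 (λ r u →
        r :+ u :+ r :+ con 2 := con 1 :+ (r :+ u :+ con 1) :+ r) refl r u))
      (≡.sym (≡.trans 2^e+1 (solve 2 (λ r u →
        (r :+ u :+ con 1) :+ (r :+ u :+ con 1) :=
        r :+ u :+ r :+ (u :+ con 1) :+ con 1) refl r u)))

  decompose : ∀ n → ∃ λ e → ∃ λ r → ∃ λ u → r + u + 1 ≡ 2 ^ e × suc n ≡ r + u + (u + 1)
  decompose zero = 0 , 0 , 0 , refl , refl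
  decompose (suc n) with decompose n
  ... | e , suc r , u , p , q = e , r , suc u ,
    ≡.trans (cong (_+ 1) (ℕₚ.+-suc r u)) p ,
    ≡.trans (cong suc q) (solve 2 (λ r u →
      con 1 :+ (con 1 :+ r :+ u :+ (u :+ con 1)) :=
      r :+ (con 1 :+ u) :+ (con 1 :+ u :+ con 1)) refl r u)
    where open +-*-Solver
  ... | e , zero , u , p , q = suc e , u + (u + 1) , 0 ,
    ≡.trans (solve 1 (λ u → u :+ (u :+ con 1) :+ con 0 :+ con 1 := con 2 :* (u :+ con 1)) refl u)
      (cong (2 *_) p) ,
    ≡.trans (cong suc q) (solve 1 (λ u →
      con 1 :+ (u :+ (u :+ con 1)) := u :+ (u :+ con 1) :+ con 0 :+ con 1) refl u)
    where open +-*-Solver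

  r<n : ∀ r u → r < r + u + (u + 1)
  r<n r u = ℕₚ.≤-<-trans (ℕₚ.m≤m+n r u) (ℕₚ.m<m+n (r + u) (ℕₚ.m≤n+m 1 u))

  hankel₂≡true : ∀ n → hankel₂ n ≡ true
  hankel₂≡true = <-rec _ λ where
    zero    ih → refl
    (suc n) ih → let e , r , u , p , q = decompose n in
      ≡.trans (cong hankel₂ q) (hankel₂-step e r u p
        (ih (subst (r <_) (≡.sym q) (r<n r u))))

  ⟦sign⟧ : ∀ k → ⟦ (-ₚ 1ₚ) ^ₚ k ⟧ ≡ true
  ⟦sign⟧ zero    = refl
  ⟦sign⟧ (suc k) = ⟦sign⟧ k

  open Sum (CommutativeRing.semiring ℤ[x]) using (sum)

  ⟦sum⟧ : ∀ n (κ : Fin (suc n) → ℕ) f p →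
          (∀ j → ⟦ p j ⟧ ≡ f (κ j) (tabulate (κ ∘ punchIn j))) →
          ⟦ sum p ⟧ ≡ select f (tabulate κ)
  ⟦sum⟧ zero    κ f p eq = cong (_xor false) (eq Fin.zero)
  ⟦sum⟧ (suc n) κ f p eq = cong₂ _xor_ (eq Fin.zero)
    (⟦sum⟧ n (κ ∘ Fin.suc) (λ d ds → f d (κ Fin.zero ∷ ds)) (p ∘ Fin.suc) (eq ∘ Fin.suc))

  ⟦det⟧ : ∀ n M (ρ κ : Fin n → ℕ) → (∀ i j → ⟦ M i j ⟧ ≡ h (ρ i) (κ j)) →
          ⟦ det ℤ[x] n M ⟧ ≡ det₂ (tabulate ρ) (tabulate κ)
  ⟦det⟧ zero    M ρ κ eq = refl
  ⟦det⟧ (suc n) M ρ κ eq = ⟦sum⟧ n κ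
    (λ c ds → h (ρ Fin.zero) c ∧ det₂ (tabulate (ρ ∘ Fin.suc)) ds)
    (λ j → (-ₚ 1ₚ) ^ₚ toℕ j *ₚ (M Fin.zero j *ₚ det ℤ[x] n λ i k → M (Fin.suc i) (punchIn j k)))
    λ j → cong₂ _∧_ (⟦sign⟧ (toℕ j)) (cong₂ _∧_ (eq Fin.zero j)
      (⟦det⟧ n (λ i k → M (Fin.suc i) (punchIn j k)) (ρ ∘ Fin.suc) (κ ∘ punchIn j)
        λ i k → eq (Fin.suc i) (punchIn j k)))

  tabulate-segment : ∀ n s → tabulate {n = n} (λ i → s + toℕ i) ≡ segment s n
  tabulate-segment zero    s = refl
  tabulate-segment (suc n) s = cong₂ _∷_ (ℕₚ.+-identityʳ s)
    (≡.trans (tabulate-cong (λ i → ℕₚ.+-suc s (toℕ i))) (tabulate-segment n (suc s)))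

  ⟦a⟧ : ∀ n → ⟦ a n ⟧ ≡ does (mersenne? n)
  ⟦a⟧ n with does (mersenne? n)
  ... | true  = refl
  ... | false = refl

  ⟦D⟧ : ∀ n → ⟦ D n ⟧ ≡ true
  ⟦D⟧ n = begin
    ⟦ D n ⟧
      ≡⟨ ⟦det⟧ n _ toℕ toℕ (λ i j → ⟦a⟧ (toℕ i + toℕ j + 1)) ⟩
    det₂ (tabulate {n = n} toℕ) (tabulate {n = n} toℕ)
      ≡⟨ cong₂ det₂ (tabulate-segment n 0) (tabulate-segment n 0) ⟩
    hankel₂ n
      ≡⟨ hankel₂≡true n ⟩
    true ∎
    where open ≡-Reasoning

  D≉0 : ∀ n → ¬ D n ≈ₚ 0ₚ
  D≉0 n eq with () ← ≡.trans (≡.sym (⟦D⟧ n)) (⟦⟧-cong eq)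

  D²≉0 : ∀ n → ¬ D n ^ₚ 2 ≈ₚ 0ₚ
  D²≉0 n eq with () ← ≡.trans (≡.sym (cong (λ b → b ∧ b ∧ true) (⟦D⟧ n))) (⟦⟧-cong eq)

open NonVanishing using (D²≉0)

RationalFunction : Set
RationalFunction = Fraction ℤ[x]

T : ℕ → RationalFunction
T n = (D n *ₚ D (n + 2)) / D (n + 1) ^ₚ 2 [ D²≉0 (n + 1) ]

{-# OPTIONS --safe #-}
module Submission where

open import Defs hiding (+-cong; *-cong; *-identityˡ)
open import Data.Fin.Base using (Fin; toℕ)
open import Data.Nat.Base using (ℕ; _+_; _*_; _∸_; _^_; _≤_)

open import Algebra.Bundles using (CommutativeRing)
import Algebra.Properties.Ring as RingProperties
import Algebra.Properties.Semiring.Exp as Exp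
import Algebra.Properties.Semiring.Sum as Sum
import Algebra.Solver.Ring.NaturalCoefficients.Default as SemiringSolver
open import Data.Bool.Base using (if_then_else_)
open import Data.Fin.Base as Fin using (punchIn)
open import Data.List.Base using (List; []; _∷_; _++_; _∷ʳ_; length; tabulate)
open import Data.List.Properties using (length-++; ++-assoc; ++-identityʳ)
open import Data.List.Relation.Binary.Permutation.Propositional
  using (_↭_; ↭-refl; ↭-sym; prep; swap; trans)
open import Data.List.Relation.Binary.Permutation.Propositional.Properties
  using (All-resp-↭; ↭-length; ++⁺ˡ; ++⁺ʳ; shift)
open import Data.List.Relation.Unary.All as All using (All; []; _∷_)
open import Data.List.Relation.Unary.All.Properties using (++⁺)
open import Data.Nat.Base using (zero; suc; pred; _<_; z≤n; s≤s)
open import Data.Nat.Induction using (<-rec)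
open import Data.Nat.Properties as ℕₚ using (suc-injective)
open import Data.Nat.Tactic.RingSolver using (solve-∀)
open import Data.Product.Base using (_,_)
open import Function.Base using (_∘_)
open import Relation.Binary.PropositionalEquality as ≡ using (_≡_; refl; cong; cong₂; subst)

-- If 2 ^ e = s + v + 1 and n = s + 2 v + 1, then the bottom right block of the
-- Hankel matrix of size n, on the indices s, …, s + 2 v, has the indeterminate
-- X = a (2 ^ (e + 1) ∸ 1) on its antidiagonal, and the last row and column of the
-- whole matrix have no other nonzero entry.  Expanding along both replaces the
-- outermost pair of block indices by the factor − X², whence
--   D n = (− X²) ^ v X D s.
-- Three consecutive such equations, with the same e, show that T m = T s for
-- m + s + 3 = 2 ^ (e + 1) and 2 ^ e ≤ m.  For m = 2 ^ (k + 1) n + 2 ^ k − 2 + j with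
-- n ≥ 1 this reflection turns (n , j) into (n′ , 1 − j) with n′ < n of the parity
-- opposite to n, and T (2 ^ k − 1) = − T (2 ^ k − 2), so induction on n applies.

-- Minors indexed by lists, and their expansion along a last row or column

module Minors {c ℓ} (R : CommutativeRing c ℓ) {I : Set}
  (M : I → I → CommutativeRing.Carrier R) where
  open CommutativeRing R using (Carrier; _≈_; 0#; 1#; -_; semiring; commutativeSemiring; setoid; ring;
    +-cong; +-congˡ; +-congʳ; *-congˡ; *-congʳ; *-cong; zeroˡ; zeroʳ; *-identityˡ)
    renaming (_+_ to infixl 6 _⊕_; _*_ to infixl 7 _⊗_; refl to ≈refl; sym to ≈sym; trans to ≈trans;
      reflexive to ≈reflexive)
  open Sum semiring using (sum)
  open Exp semiring using () renaming (_^_ to infixr 8 _^ᴿ_)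
  open SemiringSolver commutativeSemiring using (solve; con; _:+_; _:*_; _:=_)
  open RingProperties ring using (-1*x≈-x; -‿involutive)
  open import Relation.Binary.Reasoning.Setoid setoid

  -- Written as a factor, the sign is opaque to the semiring solver, and the
  -- expansion formulas become identities over a commutative semiring.
  ε : Carrier
  ε = - 1#

  -- The signed counterpart of `select`: nesting the factor `ε` gives each selected entry the sign
  -- of its position in a cofactor expansion.
  alt : (I → List I → Carrier) → List I → Carrier
  alt f []       = 0#
  alt f (c ∷ cs) = f c cs ⊕ ε ⊗ alt (λ d ds → f d (c ∷ ds)) cs

  alt-cong : ∀ {f g} cs → (∀ c ds → c ∷ ds ↭ cs → f c ds ≈ g c ds) → alt f cs ≈ alt g cs
  alt-cong []       e = ≈refl
  alt-cong (c ∷ cs) e = +-cong (e c cs ↭-refl)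
    (*-congˡ (alt-cong cs λ d ds s → e d (c ∷ ds) (trans (swap d c ↭-refl) (prep c s))))

  alt-* : ∀ k f cs → alt (λ c ds → k ⊗ f c ds) cs ≈ k ⊗ alt f cs
  alt-* k f []       = ≈sym (zeroʳ k)
  alt-* k f (c ∷ cs) = begin
    k ⊗ f c cs ⊕ ε ⊗ alt (λ d ds → k ⊗ f d (c ∷ ds)) cs
      ≈⟨ +-congˡ (*-congˡ (alt-* k (λ d ds → f d (c ∷ ds)) cs)) ⟩
    k ⊗ f c cs ⊕ ε ⊗ (k ⊗ alt (λ d ds → f d (c ∷ ds)) cs)
      ≈⟨ solve 4 (λ k u e v → k :* u :+ e :* (k :* v) := k :* (u :+ e :* v)) ≈refl k _ ε _ ⟩
    k ⊗ alt f (c ∷ cs) ∎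

  alt-0 : ∀ {f} cs → (∀ c ds → c ∷ ds ↭ cs → f c ds ≈ 0#) → alt f cs ≈ 0#
  alt-0 {f} cs e = ≈trans (alt-cong cs λ c ds s → ≈trans (e c ds s) (≈sym (zeroˡ 0#)))
    (≈trans (alt-* 0# (λ _ _ → 0#) cs) (zeroˡ _))

  alt-++ : ∀ f cs ds → alt f (cs ++ ds) ≈
    alt (λ c es → f c (es ++ ds)) cs ⊕ ε ^ᴿ length cs ⊗ alt (λ d es → f d (cs ++ es)) ds
  alt-++ f []       ds = solve 1 (λ u → u := con 0 :+ con 1 :* u) ≈refl _
  alt-++ f (c ∷ cs) ds = ≈trans
    (+-congˡ (*-congˡ (alt-++ (λ d es → f d (c ∷ es)) cs ds)))
    (solve 5 (λ u e v s w → u :+ e :* (v :+ s :* w) := (u :+ e :* v) :+ (e :* s) :* w) ≈refl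
      _ ε _ (ε ^ᴿ length cs) _)

  -- Rows and columns are lists, so that deleting one inside a block is concatenation rather than
  -- reindexing by `punchIn`. Columns left over when the rows run out are ignored, hence the length
  -- hypotheses below.
  minor : List I → List I → Carrier
  minor []       _  = 1#
  minor (r ∷ rs) cs = alt (λ c ds → M r c ⊗ minor rs ds) cs

  -- The prefactor `k` accumulates the signs of the positions already passed; the induction
  -- continues with `k ⊗ ε`.
  sum≈alt : ∀ n (κ : Fin (suc n) → I) f k p →
            (∀ j → p j ≈ k ⊗ (ε ^ᴿ toℕ j ⊗ f (κ j) (tabulate (κ ∘ punchIn j)))) →
            sum p ≈ k ⊗ alt f (tabulate κ)
  sum≈alt zero    κ f k p eq = ≈trans (+-congʳ (eq Fin.zero))
    (solve 3 (λ k u e → k :* (con 1 :* u) :+ con 0 := k :* (u :+ e :* con 0)) ≈refl k _ ε)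
  sum≈alt (suc n) κ f k p eq = ≈trans
    (+-cong (eq Fin.zero)
      (sum≈alt n (κ ∘ Fin.suc) (λ d ds → f d (κ Fin.zero ∷ ds)) (k ⊗ ε) (p ∘ Fin.suc) λ j →
        ≈trans (eq (Fin.suc j))
          (solve 4 (λ k e s u → k :* (e :* s :* u) := k :* e :* (s :* u)) ≈refl k ε (ε ^ᴿ toℕ j) _)))
    (solve 4 (λ k u e v → k :* (con 1 :* u) :+ k :* e :* v := k :* (u :+ e :* v)) ≈refl k _ ε _)

  det≈minor : ∀ n (N : Fin n → Fin n → Carrier) (ρ κ : Fin n → I) →
              (∀ i j → N i j ≈ M (ρ i) (κ j)) → det R n N ≈ minor (tabulate ρ) (tabulate κ)
  det≈minor zero    N ρ κ eq = ≈refl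
  det≈minor (suc n) N ρ κ eq = ≈trans
    (sum≈alt n κ (λ c ds → M (ρ Fin.zero) c ⊗ minor (tabulate (ρ ∘ Fin.suc)) ds) 1# _ λ j →
      ≈trans
        (*-congˡ (*-cong (eq Fin.zero j)
          (det≈minor n _ (ρ ∘ Fin.suc) (κ ∘ punchIn j) λ i k → eq (Fin.suc i) (punchIn j k))))
        (≈sym (*-identityˡ _)))
    (*-identityˡ _)

  minor-zeroRow : ∀ rs t cs → All (λ c → M t c ≈ 0#) cs → minor (rs ∷ʳ t) cs ≈ 0#
  minor-zeroRow []       t cs z = alt-0 cs λ c ds s →
    ≈trans (*-congʳ (All.head (All-resp-↭ (↭-sym s) z))) (zeroˡ _)
  minor-zeroRow (r ∷ rs) t cs z = alt-0 cs λ c ds s →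
    ≈trans (*-congˡ (minor-zeroRow rs t ds (All.tail (All-resp-↭ (↭-sym s) z)))) (zeroʳ _)

  -- The columns `cs` are too few for the rows, so every product in the expansion has to take an
  -- entry of column `t`.
  minor-zeroCol : ∀ rs cs t → length rs ≡ suc (length cs) → All (λ r → M r t ≈ 0#) rs →
                  minor rs (cs ∷ʳ t) ≈ 0#
  minor-zeroCol (r ∷ rs) cs t l (z ∷ zs) = begin
    minor (r ∷ rs) (cs ∷ʳ t)
      ≈⟨ alt-++ _ cs (t ∷ []) ⟩
    alt (λ c ds → M r c ⊗ minor rs (ds ∷ʳ t)) cs ⊕
    ε ^ᴿ length cs ⊗ (M r t ⊗ minor rs (cs ++ []) ⊕ ε ⊗ 0#)
      ≈⟨ +-cong
           (alt-0 cs λ c ds s → ≈trans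
             (*-congˡ (minor-zeroCol rs ds t (≡.trans (suc-injective l) (≡.sym (↭-length s))) zs))
             (zeroʳ _))
           (*-congˡ (+-congʳ (*-congʳ z))) ⟩
    0# ⊕ ε ^ᴿ length cs ⊗ (0# ⊗ minor rs (cs ++ []) ⊕ ε ⊗ 0#)
      ≈⟨ solve 3 (λ s u e → con 0 :+ s :* (con 0 :* u :+ e :* con 0) := con 0) ≈refl
           (ε ^ᴿ length cs) _ ε ⟩
    0# ∎

  -- Induction on the rows above `t`, expanding along the first. The columns before and after `b`
  -- are treated separately, because only the latter change the position of `b` counted from the
  -- end.
  minor-lastRow : ∀ rs t cs b ds → length rs ≡ length (cs ++ ds) →
                  All (λ c → M t c ≈ 0#) (cs ++ ds) →
                  minor (rs ∷ʳ t) (cs ++ b ∷ ds) ≈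
                  ε ^ᴿ length ds ⊗ (M t b ⊗ minor rs (cs ++ ds))
  minor-lastRow []       t []       b []  l z =
    solve 2 (λ u e → u :* con 1 :+ e :* con 0 := con 1 :* (u :* con 1)) ≈refl (M t b) ε
  minor-lastRow (r ∷ rs) t cs b ds l z = begin
    minor (r ∷ rs ∷ʳ t) (cs ++ b ∷ ds)
      ≈⟨ alt-++ _ cs (b ∷ ds) ⟩
    alt (λ c es → M r c ⊗ minor (rs ∷ʳ t) (es ++ b ∷ ds)) cs ⊕ s ⊗
    (M r b ⊗ minor (rs ∷ʳ t) (cs ++ ds) ⊕
     ε ⊗ alt (λ d es → M r d ⊗ minor (rs ∷ʳ t) (cs ++ b ∷ es)) ds)
      -- Giving column `b` to row `r` leaves row `t` with zeros only.
      ≈⟨ +-cong left (*-congˡ (+-cong (*-congˡ (minor-zeroRow rs t (cs ++ ds) z)) right)) ⟩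
    s′ ⊗ M t b ⊗ u ⊕ s ⊗ (M r b ⊗ 0# ⊕ s′ ⊗ M t b ⊗ v)
      ≈⟨ solve 6 (λ s s′ m u v n →
           s′ :* m :* u :+ s :* (n :* con 0 :+ s′ :* m :* v) := s′ :* (m :* (u :+ s :* v)))
           ≈refl s s′ (M t b) u v (M r b) ⟩
    s′ ⊗ (M t b ⊗ (u ⊕ s ⊗ v))
      ≈⟨ *-congˡ (*-congˡ (alt-++ _ cs ds)) ⟨
    s′ ⊗ (M t b ⊗ minor (r ∷ rs) (cs ++ ds)) ∎
    where
    s  = ε ^ᴿ length cs
    s′ = ε ^ᴿ length ds
    u  = alt (λ c es → M r c ⊗ minor rs (es ++ ds)) cs
    v  = alt (λ d es → M r d ⊗ minor rs (cs ++ es)) ds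

    length′ : ∀ {c es} → c ∷ es ↭ cs ++ ds → length rs ≡ length es
    length′ p = suc-injective (≡.trans l (≡.sym (↭-length p)))

    z′ : ∀ {c es} → c ∷ es ↭ cs ++ ds → All (λ c → M t c ≈ 0#) es
    z′ p = All.tail (All-resp-↭ (↭-sym p) z)

    left : alt (λ c es → M r c ⊗ minor (rs ∷ʳ t) (es ++ b ∷ ds)) cs ≈ s′ ⊗ M t b ⊗ u
    left = ≈trans
      (alt-cong cs λ c es p → let q = ++⁺ʳ ds p in ≈trans
        (*-congˡ (minor-lastRow rs t es b ds (length′ q) (z′ q)))
        (solve 4 (λ n s′ m w → n :* (s′ :* (m :* w)) := s′ :* m :* (n :* w)) ≈refl
          (M r c) s′ (M t b) _))
      (alt-* (s′ ⊗ M t b) _ cs)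

    -- Deleting an entry behind `b` lowers the exponent by one; the `ε` picked up on passing `b`
    -- restores it.
    right : ε ⊗ alt (λ d es → M r d ⊗ minor (rs ∷ʳ t) (cs ++ b ∷ es)) ds ≈ s′ ⊗ M t b ⊗ v
    right = ≈trans (≈sym (alt-* ε _ ds)) (≈trans
      (alt-cong ds λ d es p →
        let q = trans (↭-sym (shift d cs es)) (++⁺ˡ cs p) in ≈trans
        (*-congˡ (*-congˡ (minor-lastRow rs t cs b es (length′ q) (z′ q))))
        (≈trans
          (solve 5 (λ e n s m w → e :* (n :* (s :* (m :* w))) := e :* s :* m :* (n :* w)) ≈refl
            ε (M r d) (ε ^ᴿ length es) (M t b) _)
          (*-congʳ (*-congʳ (≈reflexive (cong (ε ^ᴿ_) (↭-length p)))))))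
      (alt-* (s′ ⊗ M t b) _ ds))

  -- Rows above `b` cannot use column `t`, and deleting another column leaves `t` last. Row `b` must
  -- use it, since otherwise a zero column remains; as many columns as `rs′` has rows precede it
  -- then, which gives the sign.
  minor-lastCol : ∀ rs b rs′ cs t → length (rs ++ rs′) ≡ length cs →
                  All (λ r → M r t ≈ 0#) (rs ++ rs′) →
                  minor (rs ++ b ∷ rs′) (cs ∷ʳ t) ≈
                  ε ^ᴿ length rs′ ⊗ (M b t ⊗ minor (rs ++ rs′) cs)
  minor-lastCol [] b rs′ cs t l z = begin
    minor (b ∷ rs′) (cs ∷ʳ t)
      ≈⟨ alt-++ _ cs (t ∷ []) ⟩
    alt (λ c ds → M b c ⊗ minor rs′ (ds ∷ʳ t)) cs ⊕
    ε ^ᴿ length cs ⊗ (M b t ⊗ minor rs′ (cs ++ []) ⊕ ε ⊗ 0#)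
      ≈⟨ +-cong
           (alt-0 cs λ c ds p → ≈trans
             (*-congˡ (minor-zeroCol rs′ ds t (≡.trans l (≡.sym (↭-length p))) z))
             (zeroʳ _))
           (*-cong (≈reflexive (cong (ε ^ᴿ_) (≡.sym l)))
             (+-congʳ (*-congˡ (≈reflexive (cong (minor rs′) (++-identityʳ cs)))))) ⟩
    0# ⊕ ε ^ᴿ length rs′ ⊗ (M b t ⊗ minor rs′ cs ⊕ ε ⊗ 0#)
      ≈⟨ solve 4 (λ s m u e → con 0 :+ s :* (m :* u :+ e :* con 0) := s :* (m :* u)) ≈refl
           (ε ^ᴿ length rs′) (M b t) _ ε ⟩
    ε ^ᴿ length rs′ ⊗ (M b t ⊗ minor rs′ cs) ∎
  minor-lastCol (r ∷ rs) b rs′ cs t l (z ∷ zs) = begin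
    minor (r ∷ rs ++ b ∷ rs′) (cs ∷ʳ t)
      ≈⟨ alt-++ _ cs (t ∷ []) ⟩
    alt (λ c ds → M r c ⊗ minor (rs ++ b ∷ rs′) (ds ∷ʳ t)) cs ⊕
    ε ^ᴿ length cs ⊗ (M r t ⊗ minor (rs ++ b ∷ rs′) (cs ++ []) ⊕ ε ⊗ 0#)
      ≈⟨ +-cong
           (alt-cong cs λ c ds p → ≈trans
             (*-congˡ (minor-lastCol rs b rs′ ds t
               (suc-injective (≡.trans l (≡.sym (↭-length p)))) zs))
             (solve 4 (λ n s m w → n :* (s :* (m :* w)) := s :* m :* (n :* w)) ≈refl
               (M r c) (ε ^ᴿ length rs′) (M b t) _))
           (*-congˡ (+-congʳ (*-congʳ z))) ⟩
    alt (λ c ds → ε ^ᴿ length rs′ ⊗ M b t ⊗ (M r c ⊗ minor (rs ++ rs′) ds)) cs ⊕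
    ε ^ᴿ length cs ⊗ (0# ⊗ minor (rs ++ b ∷ rs′) (cs ++ []) ⊕ ε ⊗ 0#)
      ≈⟨ +-congʳ (alt-* (ε ^ᴿ length rs′ ⊗ M b t) _ cs) ⟩
    ε ^ᴿ length rs′ ⊗ M b t ⊗ minor (r ∷ rs ++ rs′) cs ⊕
    ε ^ᴿ length cs ⊗ (0# ⊗ minor (rs ++ b ∷ rs′) (cs ++ []) ⊕ ε ⊗ 0#)
      ≈⟨ solve 6 (λ s m u s′ v e →
           s :* m :* u :+ s′ :* (con 0 :* v :+ e :* con 0) := s :* (m :* u)) ≈refl
           (ε ^ᴿ length rs′) (M b t) _ (ε ^ᴿ length cs) _ ε ⟩
    ε ^ᴿ length rs′ ⊗ (M b t ⊗ minor (r ∷ rs ++ rs′) cs) ∎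

  ε^n⊗ε^n≈1 : ∀ n → ε ^ᴿ n ⊗ ε ^ᴿ n ≈ 1#
  ε^n⊗ε^n≈1 zero    = *-identityˡ 1#
  ε^n⊗ε^n≈1 (suc n) = ≈trans
    (solve 2 (λ e s → e :* s :* (e :* s) := e :* e :* (s :* s)) ≈refl ε (ε ^ᴿ n))
    (≈trans (*-cong (≈trans (-1*x≈-x ε) (-‿involutive 1#)) (ε^n⊗ε^n≈1 n)) (*-identityˡ 1#))

  -- Expanding along row `t` and then along column `t` gives signs with exponents `suc (length qs)`
  -- and `length qs`, so a single `ε` survives whatever the length of `qs`.
  minor-frame : ∀ ps b qs t →
                All (λ c → M t c ≈ 0#) (ps ++ qs ∷ʳ t) → All (λ r → M r t ≈ 0#) (ps ++ qs) →
                minor (ps ++ b ∷ qs ∷ʳ t) (ps ++ b ∷ qs ∷ʳ t) ≈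
                ε ⊗ (M t b ⊗ M b t) ⊗ minor (ps ++ qs) (ps ++ qs)
  minor-frame ps b qs t z z′ = begin
    minor (ps ++ b ∷ qs ∷ʳ t) (ps ++ b ∷ qs ∷ʳ t)
      ≡⟨ cong (λ rs → minor rs (ps ++ b ∷ qs ∷ʳ t)) (++-assoc ps (b ∷ qs) (t ∷ [])) ⟨
    minor ((ps ++ b ∷ qs) ∷ʳ t) (ps ++ b ∷ qs ∷ʳ t)
      ≈⟨ minor-lastRow (ps ++ b ∷ qs) t ps b (qs ∷ʳ t) len z ⟩
    ε ^ᴿ length (qs ∷ʳ t) ⊗ (M t b ⊗ minor (ps ++ b ∷ qs) (ps ++ qs ∷ʳ t))
      ≈⟨ *-cong (≈reflexive (cong (ε ^ᴿ_) (length-∷ʳ qs)))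
           (*-congˡ (≈reflexive (cong (minor (ps ++ b ∷ qs)) (≡.sym (++-assoc ps qs (t ∷ [])))))) ⟩
    ε ⊗ s ⊗ (M t b ⊗ minor (ps ++ b ∷ qs) ((ps ++ qs) ∷ʳ t))
      ≈⟨ *-congˡ (*-congˡ (minor-lastCol ps b qs (ps ++ qs) t refl z′)) ⟩
    ε ⊗ s ⊗ (M t b ⊗ (s ⊗ (M b t ⊗ minor (ps ++ qs) (ps ++ qs))))
      ≈⟨ solve 5 (λ e s m n u → e :* s :* (m :* (s :* (n :* u))) := s :* s :* (e :* (m :* n) :* u))
           ≈refl ε s (M t b) (M b t) _ ⟩
    s ⊗ s ⊗ (ε ⊗ (M t b ⊗ M b t) ⊗ minor (ps ++ qs) (ps ++ qs))
      ≈⟨ ≈trans (*-congʳ (ε^n⊗ε^n≈1 (length qs))) (*-identityˡ _) ⟩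
    ε ⊗ (M t b ⊗ M b t) ⊗ minor (ps ++ qs) (ps ++ qs) ∎
    where
    s = ε ^ᴿ length qs

    length-∷ʳ : ∀ {y : I} xs → length (xs ∷ʳ y) ≡ suc (length xs)
    length-∷ʳ xs = ≡.trans (length-++ xs) (ℕₚ.+-comm (length xs) 1)

    len : length (ps ++ b ∷ qs) ≡ length (ps ++ qs ∷ʳ t)
    len = ≡.trans (length-++ ps)
      (≡.trans (cong (length ps +_) (≡.sym (length-∷ʳ qs))) (≡.sym (length-++ ps)))

-- The Hankel matrix and the zeros around its antidiagonal block

H : ℕ → ℕ → Polynomial
H i j = a (i + j + 1)

module ℤ[x] = CommutativeRing ℤ[x]
open Exp ℤ[x].semiring using (^-congˡ; ^-homo-*)
open Minors ℤ[x] H using (minor; ε; det≈minor; minor-lastRow; minor-frame; ε^n⊗ε^n≈1)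
open NonVanishing using (segment; segment-++; segment-All; tabulate-segment; h-true; h-false;
  decompose; r<n)
open SemiringSolver ℤ[x].commutativeSemiring using (con; _:*_; _:^_; _:=_)
  renaming (solve to solveₚ)
open import Relation.Binary.Reasoning.Setoid ℤ[x].setoid

X : ℕ → Polynomial
X e = x (2 ^ suc e ∸ 1)

Y : ℕ → Polynomial
Y e = ε *ₚ (X e *ₚ X e)

H-comm : ∀ i j → H i j ≡ H j i
H-comm i j = cong (λ k → a (k + 1)) (ℕₚ.+-comm i j)

-- An entry can be nonzero only where `i + j + 2` is a power of two, and here it lies strictly
-- between two consecutive ones.
H-zero : ∀ e i j → 2 ^ e < i + j + 2 → i + j + 2 < 2 ^ suc e → H i j ≈ₚ 0ₚ
H-zero e i j lo hi = ℤ[x].reflexive (cong (if_then x (i + j + 1) else 0ₚ) (h-false e i j lo hi))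

H-peak : ∀ e i j → i + j + 2 ≡ 2 ^ suc e → H i j ≡ X e
H-peak e i j eq = ≡.trans (cong (if_then x (i + j + 1) else 0ₚ) (h-true (suc e) i j eq))
  (cong x (≡.trans (cong pred (≡.sym (ℕₚ.+-suc (i + j) 1))) (cong (_∸ 1) eq)))

-- With the slack `d` explicit, a strict inequality becomes an equation for `solve-∀`.
m+1+d≡n⇒m<n : ∀ {m n} d → suc m + d ≡ n → m < n
m+1+d≡n⇒m<n d refl = ℕₚ.m≤m+n _ d

module _ (e s v : ℕ) (s+v+1≡2^e : s + v + 1 ≡ 2 ^ e) where

  -- For the row t = s + 2 v, the value t + c + 2 reaches 2 ^ (e + 1) exactly at c = s. To the left
  -- it stays above 2 ^ e, because t + 2 > s + v + 1; to the right, up to the diagonal, it stays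
  -- below 2 ^ (e + 2), because 2 t + 2 < 4 (s + v + 1).
  H-zero-left : ∀ c → c < s → H (s + (v + v)) c ≈ₚ 0ₚ
  H-zero-left c c<s with d , refl ← ℕₚ.m≤n⇒∃[o]m+o≡n c<s = H-zero e (suc c + d + (v + v)) c
    (m+1+d≡n⇒m<n (v + c) (≡.trans (cong (λ p → suc p + (v + c)) (≡.sym s+v+1≡2^e)) (lo c d v)))
    (m+1+d≡n⇒m<n d (≡.trans (hi c d v) (cong (2 *_) s+v+1≡2^e)))
    where
    lo : ∀ c d v → suc (suc c + d + v + 1) + (v + c) ≡ suc c + d + (v + v) + c + 2
    lo = solve-∀
    hi : ∀ c d v → suc (suc c + d + (v + v) + c + 2) + d ≡ 2 * (suc c + d + v + 1)
    hi = solve-∀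

  H-zero-right : ∀ c → s < c → c ≤ s + (v + v) → H (s + (v + v)) c ≈ₚ 0ₚ
  H-zero-right c s<c c≤t with d , refl ← ℕₚ.m≤n⇒∃[o]m+o≡n s<c = H-zero
    (suc e) (s + (v + v)) (suc s + d)
    (m+1+d≡n⇒m<n d (≡.trans (cong (λ p → suc (2 * p) + d) (≡.sym s+v+1≡2^e)) (lo s d v)))
    (ℕₚ.≤-<-trans (ℕₚ.+-monoˡ-≤ 2 (ℕₚ.+-monoʳ-≤ (s + (v + v)) c≤t))
      (m+1+d≡n⇒m<n (s + s + 1) (≡.trans (hi s v) (cong (λ p → 2 * (2 * p)) s+v+1≡2^e))))
    where
    lo : ∀ s d v → suc (2 * (s + v + 1)) + d ≡ s + (v + v) + (suc s + d) + 2
    lo = solve-∀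
    hi : ∀ s v → suc (s + (v + v) + (s + (v + v)) + 2) + (s + s + 1) ≡ 2 * (2 * (s + v + 1))
    hi = solve-∀

  H-antidiagonal : H (s + (v + v)) s ≡ X e
  H-antidiagonal = H-peak e (s + (v + v)) s (≡.trans (eq s v) (cong (2 *_) s+v+1≡2^e))
    where
    eq : ∀ s v → s + (v + v) + s + 2 ≡ 2 * (s + v + 1)
    eq = solve-∀

-- Peeling the block: the reflection formula for the determinants

principal : List ℕ → Polynomial
principal is = minor is is

-- The start of the block is decoupled from `r`, since each peeling passes from `s` and `suc v` to
-- `suc s` and `v`. This keeps s + v + 1, hence `e`, and leaves the first segment in place.
principal-block : ∀ e r s v → r ≤ s → s + v + 1 ≡ 2 ^ e →
                  principal (segment 0 r ++ segment s (suc (v + v))) ≈ₚ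
                  Y e ^ₚ v *ₚ (X e *ₚ principal (segment 0 r))
principal-block e r s zero r≤s eq = begin
  minor (R ∷ʳ s) (R ∷ʳ s)
    -- The middle of the antidiagonal remains: one index, with diagonal entry `X e`.
    ≈⟨ minor-lastRow R s R s [] (cong length (≡.sym (++-identityʳ R)))
         (++⁺ (segment-All 0 r λ c _ c<r →
           ℤ[x].trans (ℤ[x].reflexive (cong (λ t → H t c) (≡.sym (ℕₚ.+-identityʳ s))))
             (H-zero-left e s 0 eq c (ℕₚ.<-≤-trans c<r r≤s))) []) ⟩
  1ₚ *ₚ (H s s *ₚ minor R (R ++ []))
    ≈⟨ ℤ[x].*-congˡ (ℤ[x].*-cong
         (ℤ[x].reflexive (≡.trans (cong (λ t → H t s) (≡.sym (ℕₚ.+-identityʳ s)))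
           (H-antidiagonal e s 0 eq)))
         (ℤ[x].reflexive (cong (minor R) (++-identityʳ R)))) ⟩
  1ₚ *ₚ (X e *ₚ principal R) ∎
  where R = segment 0 r
principal-block e r s (suc v) r≤s eq = begin
  principal (R ++ segment s (suc (suc v + suc v)))
    ≡⟨ cong (λ is → principal (R ++ s ∷ is)) split ⟩
  principal (R ++ s ∷ Q ∷ʳ t)
    ≈⟨ minor-frame R s Q t
         (++⁺ zeroR (++⁺ zeroQ (H-zero-right e s (suc v) eq t s<t ℕₚ.≤-refl ∷ [])))
         (All.map (λ {c} → ℤ[x].trans (ℤ[x].reflexive (H-comm c t))) (++⁺ zeroR zeroQ)) ⟩
  ε *ₚ (H t s *ₚ H s t) *ₚ principal (R ++ Q)
    ≈⟨ ℤ[x].*-cong (ℤ[x].reflexive (cong₂ (λ p q → ε *ₚ (p *ₚ q)) peak (≡.trans (H-comm s t) peak)))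
         (principal-block e r (suc s) v (ℕₚ.m≤n⇒m≤1+n r≤s)
           (≡.trans (cong (_+ 1) (≡.sym (ℕₚ.+-suc s v))) eq)) ⟩
  Y e *ₚ (Y e ^ₚ v *ₚ (X e *ₚ principal R))
    ≈⟨ ℤ[x].*-assoc (Y e) (Y e ^ₚ v) _ ⟨
  Y e ^ₚ suc v *ₚ (X e *ₚ principal R) ∎
  where
  R = segment 0 r
  Q = segment (suc s) (suc (v + v))
  t = s + (suc v + suc v)

  peak : H t s ≡ X e
  peak = H-antidiagonal e s (suc v) eq

  s<t : s < t
  s<t = ℕₚ.m<m+n s (s≤s z≤n)

  split : segment (suc s) (suc v + suc v) ≡ Q ∷ʳ t
  split = ≡.trans (cong (segment (suc s)) (l v))
    (≡.trans (segment-++ (suc s) (suc (v + v)) 1) (cong (Q ∷ʳ_) (l′ s v)))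
    where
    l : ∀ v → suc v + suc v ≡ suc (v + v) + 1
    l = solve-∀
    l′ : ∀ s v → suc s + suc (v + v) ≡ s + (suc v + suc v)
    l′ = solve-∀

  zeroR : All (λ c → H t c ≈ₚ 0ₚ) R
  zeroR = segment-All 0 r λ c _ c<r → H-zero-left e s (suc v) eq c (ℕₚ.<-≤-trans c<r r≤s)

  zeroQ : All (λ c → H t c ≈ₚ 0ₚ) Q
  zeroQ = segment-All (suc s) (suc (v + v)) λ c s<c c<t → H-zero-right e s (suc v) eq c s<c
    (ℕₚ.≤-trans (ℕₚ.<⇒≤ c<t) (ℕₚ.≤-reflexive (l s v)))
    where
    l : ∀ s v → suc s + suc (v + v) ≡ s + (suc v + suc v)
    l = solve-∀

D≈principal : ∀ n → D n ≈ₚ principal (segment 0 n)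
D≈principal n = ℤ[x].trans (det≈minor n _ toℕ toℕ λ _ _ → ≈-refl)
  (ℤ[x].reflexive (cong principal (tabulate-segment n 0)))

D-reflect : ∀ e s v {n} → s + v + 1 ≡ 2 ^ e → n ≡ s + suc (v + v) →
            D n ≈ₚ Y e ^ₚ v *ₚ (X e *ₚ D s)
D-reflect e s v eq refl = begin
  D (s + suc (v + v))
    ≈⟨ D≈principal (s + suc (v + v)) ⟩
  principal (segment 0 (s + suc (v + v)))
    ≡⟨ cong principal (segment-++ 0 s (suc (v + v))) ⟩
  principal (segment 0 s ++ segment s (suc (v + v)))
    ≈⟨ principal-block e s s v ℕₚ.≤-refl eq ⟩
  Y e ^ₚ v *ₚ (X e *ₚ principal (segment 0 s))
    ≈⟨ ℤ[x].*-congˡ (ℤ[x].*-congˡ (D≈principal s)) ⟨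
  Y e ^ₚ v *ₚ (X e *ₚ D s) ∎

-- Reflection of the quotients

-- Writing T m as σ A / B up to a common factor allows two of these fractions to be
-- compared without cancelling factors in ℤ[x].
record Expansion (A B σ : Polynomial) (m : ℕ) : Set where
  constructor expand
  field
    factor : Polynomial
    num≈   : D m *ₚ D (m + 2) ≈ₚ σ *ₚ (factor *ₚ A)
    den≈   : D (m + 1) ^ₚ 2 ≈ₚ factor *ₚ B

-- Reflection reverses the three determinants: `D m`, `D (m + 1)`, `D (m + 2)` come from
-- `D (s + 2)`, `D (s + 1)`, `D s`, with powers v, v + 1, v + 2 of `Y e`. Numerator and denominator
-- thus both gain the square of Y ^ (v + 1) X.
Expansion-reflect : ∀ {A B σ} e s v {m} → s + 2 + v + 1 ≡ 2 ^ e → m ≡ s + 2 + suc (v + v) →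
                    Expansion A B σ s → Expansion A B σ m
Expansion-reflect {A} {B} {σ} e s v {m} eq m≡ (expand c p q) = expand (y *ₚ ξ *ₚ (y *ₚ ξ) *ₚ c)
  (begin
    D m *ₚ D (m + 2)
      ≈⟨ ℤ[x].*-cong (D-reflect e (s + 2) v eq m≡)
           (D-reflect e s (suc (suc v)) (≡.trans (l₂ s v) eq) (≡.trans (cong (_+ 2) m≡) (r₂ s v))) ⟩
    Y e ^ₚ v *ₚ (ξ *ₚ D (s + 2)) *ₚ (Y e *ₚ (Y e *ₚ Y e ^ₚ v) *ₚ (ξ *ₚ D s))
      ≈⟨ solveₚ 5 (λ η w ξ d d′ → w :* (ξ :* d′) :* (η :* (η :* w) :* (ξ :* d)) :=
           η :* w :* ξ :* (η :* w :* ξ) :* (d :* d′)) ≈-refl (Y e) (Y e ^ₚ v) ξ (D s) (D (s + 2)) ⟩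
    y *ₚ ξ *ₚ (y *ₚ ξ) *ₚ (D s *ₚ D (s + 2))
      ≈⟨ ℤ[x].*-congˡ p ⟩
    y *ₚ ξ *ₚ (y *ₚ ξ) *ₚ (σ *ₚ (c *ₚ A))
      ≈⟨ solveₚ 4 (λ f σ c A → f :* (σ :* (c :* A)) := σ :* (f :* c :* A)) ≈-refl
           (y *ₚ ξ *ₚ (y *ₚ ξ)) σ c A ⟩
    σ *ₚ (y *ₚ ξ *ₚ (y *ₚ ξ) *ₚ c *ₚ A) ∎)
  (begin
    D (m + 1) ^ₚ 2
      ≈⟨ ^-congˡ 2 (D-reflect e (s + 1) (suc v) (≡.trans (l₁ s v) eq)
           (≡.trans (cong (_+ 1) m≡) (r₁ s v))) ⟩
    (y *ₚ (ξ *ₚ D (s + 1))) ^ₚ 2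
      ≈⟨ solveₚ 3 (λ y ξ d → (y :* (ξ :* d)) :^ 2 := y :* ξ :* (y :* ξ) :* d :^ 2) ≈-refl
           y ξ (D (s + 1)) ⟩
    y *ₚ ξ *ₚ (y *ₚ ξ) *ₚ D (s + 1) ^ₚ 2
      ≈⟨ ℤ[x].*-congˡ q ⟩
    y *ₚ ξ *ₚ (y *ₚ ξ) *ₚ (c *ₚ B)
      ≈⟨ ℤ[x].*-assoc _ c B ⟨
    y *ₚ ξ *ₚ (y *ₚ ξ) *ₚ c *ₚ B ∎)
  where
  y = Y e ^ₚ suc v
  ξ = X e
  l₁ : ∀ s v → s + 1 + suc v + 1 ≡ s + 2 + v + 1
  l₁ = solve-∀
  l₂ : ∀ s v → s + suc (suc v) + 1 ≡ s + 2 + v + 1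
  l₂ = solve-∀
  r₁ : ∀ s v → s + 2 + suc (v + v) + 1 ≡ s + 1 + suc (suc v + suc v)
  r₁ = solve-∀
  r₂ : ∀ s v → s + 2 + suc (v + v) + 2 ≡ s + suc (suc (suc v) + suc (suc v))
  r₂ = solve-∀

ε^-even : ∀ p u → ε ^ₚ (p + (u + u)) ≈ₚ ε ^ₚ p
ε^-even p u = begin
  ε ^ₚ (p + (u + u))            ≈⟨ ^-homo-* ε p (u + u) ⟩
  ε ^ₚ p *ₚ ε ^ₚ (u + u)        ≈⟨ ℤ[x].*-congˡ (^-homo-* ε u u) ⟩
  ε ^ₚ p *ₚ (ε ^ₚ u *ₚ ε ^ₚ u)  ≈⟨ ℤ[x].*-congˡ (ε^n⊗ε^n≈1 u) ⟩
  ε ^ₚ p *ₚ 1ₚ                  ≈⟨ ℤ[x].*-identityʳ (ε ^ₚ p) ⟩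
  ε ^ₚ p                        ∎

-- Induction on n for fixed k, with q = 2 ^ k - 2

module _ (k q : ℕ) (q+2≡2^k : q + 2 ≡ 2 ^ k) where

  -- The reference fraction is `T q` with one factor `D (q + 1)` cancelled, since `D (q + 2)` is
  -- `X k` times `D (q + 1)`.
  Expansion′ : Polynomial → ℕ → Set
  Expansion′ = Expansion (X k *ₚ D q) (D (q + 1))

  2^[k+1]≡2[q+2] : 2 ^ (k + 1) ≡ 2 * (q + 2)
  2^[k+1]≡2[q+2] = ≡.trans (cong (2 ^_) (ℕₚ.+-comm k 1)) (cong (2 *_) (≡.sym q+2≡2^k))

  D[q+2]≈ : ∀ {n} → n ≡ q + 2 → D n ≈ₚ 1ₚ *ₚ (X k *ₚ D (q + 1))
  D[q+2]≈ eq = D-reflect k (q + 1) 0 (≡.trans (l q) q+2≡2^k) (≡.trans eq (r q))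
    where
    l : ∀ q → q + 1 + 0 + 1 ≡ q + 2
    l = solve-∀
    r : ∀ q → q + 2 ≡ q + 1 + suc (0 + 0)
    r = solve-∀

  -- For j = 1, reflecting with v = 1 expresses `D (q + 3)` through `D q`, and the single factor
  -- `Y k` supplies the sign.
  Expansion-base : ∀ (j : Fin 2) → Expansion′ (ε ^ₚ toℕ j) (q + toℕ j)
  Expansion-base Fin.zero = expand (D (q + 1))
    (begin
      D (q + 0) *ₚ D (q + 0 + 2)
        ≈⟨ ℤ[x].*-cong (ℤ[x].reflexive (cong D (ℕₚ.+-identityʳ q)))
             (D[q+2]≈ (cong (_+ 2) (ℕₚ.+-identityʳ q))) ⟩
      D q *ₚ (1ₚ *ₚ (X k *ₚ D (q + 1)))
        ≈⟨ solveₚ 3 (λ d ξ d′ → d :* (con 1 :* (ξ :* d′)) := con 1 :* (d′ :* (ξ :* d))) ≈-refl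
             (D q) (X k) (D (q + 1)) ⟩
      1ₚ *ₚ (D (q + 1) *ₚ (X k *ₚ D q)) ∎)
    (begin
      D (q + 0 + 1) ^ₚ 2
        ≡⟨ cong (λ n → D (n + 1) ^ₚ 2) (ℕₚ.+-identityʳ q) ⟩
      D (q + 1) ^ₚ 2
        ≈⟨ solveₚ 1 (λ d → d :^ 2 := d :* d) ≈-refl (D (q + 1)) ⟩
      D (q + 1) *ₚ D (q + 1) ∎)
  Expansion-base (Fin.suc Fin.zero) = expand (X k *ₚ X k *ₚ D (q + 1))
    (begin
      D (q + 1) *ₚ D (q + 1 + 2)
        ≈⟨ ℤ[x].*-congˡ (D-reflect k q 1 (≡.trans (ℕₚ.+-assoc q 1 1) q+2≡2^k) (ℕₚ.+-assoc q 1 2)) ⟩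
      D (q + 1) *ₚ (Y k ^ₚ 1 *ₚ (X k *ₚ D q))
        ≈⟨ solveₚ 4 (λ d e ξ d′ → d′ :* ((e :* (ξ :* ξ)) :^ 1 :* (ξ :* d)) :=
             e :^ 1 :* (ξ :* ξ :* d′ :* (ξ :* d))) ≈-refl (D q) ε (X k) (D (q + 1)) ⟩
      ε ^ₚ 1 *ₚ (X k *ₚ X k *ₚ D (q + 1) *ₚ (X k *ₚ D q)) ∎)
    (begin
      D (q + 1 + 1) ^ₚ 2
        ≈⟨ ^-congˡ 2 (D[q+2]≈ (ℕₚ.+-assoc q 1 1)) ⟩
      (1ₚ *ₚ (X k *ₚ D (q + 1))) ^ₚ 2
        ≈⟨ solveₚ 2 (λ ξ d → (con 1 :* (ξ :* d)) :^ 2 := ξ :* ξ :* d :* d) ≈-refl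
             (X k) (D (q + 1)) ⟩
      X k *ₚ X k *ₚ D (q + 1) *ₚ D (q + 1) ∎)

  -- Put n = r + 2 u + 1. As i + i′ = 1, the two indices plus 3 add up to 2 ^ (k + 1) (n + r) + 2 (q
  -- + 2) = 2 ^ (k + 1) (n + r + 1) = 2 ^ (e + k + 2), as the reflection requires.
  Expansion-step : ∀ e r u i i′ → r + u + 1 ≡ 2 ^ e → i + i′ ≡ 1 →
                   Expansion′ (ε ^ₚ (r + i′)) (2 ^ (k + 1) * r + (q + i′)) →
                   Expansion′ (ε ^ₚ (r + i′)) (2 ^ (k + 1) * (r + u + (u + 1)) + (q + i))
  -- The last argument is the v for which the two indices differ by 2 v + 3.
  Expansion-step e r u i i′ eq i+i′≡1 = Expansion-reflect (e + (k + 1))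
    (2 ^ (k + 1) * r + (q + i′)) (2 ^ (k + 1) * u + (q + i)) sum≡ index≡
    where
    sum≡ : 2 ^ (k + 1) * r + (q + i′) + 2 + (2 ^ (k + 1) * u + (q + i)) + 1 ≡ 2 ^ (e + (k + 1))
    sum≡ rewrite ℕₚ.^-distribˡ-+-* 2 e (k + 1) | 2^[k+1]≡2[q+2] | ≡.sym eq =
      -- The term i + i′ is isolated, so that its value can be substituted between two identities of
      -- polynomials.
      ≡.trans (l q r u i i′) (≡.trans (cong (2 * (q + 2) * (r + u) + (q + q + 3) +_) i+i′≡1) (l′ q r u))
      where
      l : ∀ q r u i i′ → 2 * (q + 2) * r + (q + i′) + 2 + (2 * (q + 2) * u + (q + i)) + 1 ≡
                         2 * (q + 2) * (r + u) + (q + q + 3) + (i + i′)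
      l = solve-∀
      l′ : ∀ q r u → 2 * (q + 2) * (r + u) + (q + q + 3) + 1 ≡ (r + u + 1) * (2 * (q + 2))
      l′ = solve-∀

    index≡ : 2 ^ (k + 1) * (r + u + (u + 1)) + (q + i) ≡
             2 ^ (k + 1) * r + (q + i′) + 2 +
             suc (2 ^ (k + 1) * u + (q + i) + (2 ^ (k + 1) * u + (q + i)))
    index≡ rewrite 2^[k+1]≡2[q+2] =
      ≡.trans (l q r u i) (≡.trans (cong (common +_) (≡.sym i+i′≡1)) (l′ q r u i i′))
      where
      common = 2 * (q + 2) * (r + u + u) + (q + q + q + 3 + i)
      l : ∀ q r u i → 2 * (q + 2) * (r + u + (u + 1)) + (q + i) ≡
                      2 * (q + 2) * (r + u + u) + (q + q + q + 3 + i) + 1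
      l = solve-∀
      l′ : ∀ q r u i i′ → 2 * (q + 2) * (r + u + u) + (q + q + q + 3 + i) + (i + i′) ≡
                          2 * (q + 2) * r + (q + i′) + 2 +
                          suc (2 * (q + 2) * u + (q + i) + (2 * (q + 2) * u + (q + i)))
      l′ = solve-∀

  Expansion-resp : ∀ {σ τ m n} → σ ≈ₚ τ → m ≡ n → Expansion′ σ m → Expansion′ τ n
  Expansion-resp σ≈τ refl (expand c p q) = expand c (ℤ[x].trans p (ℤ[x].*-congʳ σ≈τ)) q

  -- The exponents n + j and r + (1 - j) differ by the even number 2 u or 2 (u + 1), so the
  -- reflection preserves the sign while exchanging the values of j.
  Expansion-parity : ∀ e r u (j : Fin 2) {n} → r + u + 1 ≡ 2 ^ e → n ≡ r + u + (u + 1) →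
                     (∀ (j : Fin 2) → Expansion′ (ε ^ₚ (r + toℕ j)) (2 ^ (k + 1) * r + (q + toℕ j))) →
                     Expansion′ (ε ^ₚ (n + toℕ j)) (2 ^ (k + 1) * (r + u + (u + 1)) + (q + toℕ j))
  Expansion-parity e r u Fin.zero           eq refl ih = Expansion-resp
    (ℤ[x].sym (ℤ[x].trans (ℤ[x].reflexive (cong (ε ^ₚ_) (l r u))) (ε^-even (r + 1) u))) refl
    (Expansion-step e r u 0 1 eq refl (ih (Fin.suc Fin.zero)))
    where
    l : ∀ r u → r + u + (u + 1) + 0 ≡ r + 1 + (u + u)
    l = solve-∀
  Expansion-parity e r u (Fin.suc Fin.zero) eq refl ih = Expansion-resp
    (ℤ[x].sym (ℤ[x].trans (ℤ[x].reflexive (cong (ε ^ₚ_) (l r u))) (ε^-even (r + 0) (suc u)))) refl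
    (Expansion-step e r u 1 0 eq refl (ih Fin.zero))
    where
    l : ∀ r u → r + u + (u + 1) + 1 ≡ r + 0 + (suc u + suc u)
    l = solve-∀

  -- Because reflection exchanges the two values of j, both are compared with the same fraction
  -- `T q`, whence the exponent n + j. The induction is strong: `decompose` removes the leading
  -- power of two of n and may yield any smaller r.
  expansion : ∀ n (j : Fin 2) → Expansion′ (ε ^ₚ (n + toℕ j)) (2 ^ (k + 1) * n + (q + toℕ j))
  expansion = <-rec _ λ where
    zero    ih j → Expansion-resp ≈-refl
      (cong (_+ (q + toℕ j)) (≡.sym (ℕₚ.*-zeroʳ (2 ^ (k + 1))))) (Expansion-base j)
    (suc n) ih j → let e , r , u , eq , n≡ = decompose n in
      Expansion-resp ≈-refl (cong (λ n → 2 ^ (k + 1) * n + (q + toℕ j)) (≡.sym n≡))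
        (Expansion-parity e r u j eq n≡ (ih (subst (r <_) (≡.sym n≡) (r<n r u))))

-- Comparison of the two quotients

-- After cross-multiplication both sides are the product of `σ`, `τ`, `A`, `B` and the two common
-- factors.
T-proportional : ∀ {A B} σ τ m n → Expansion A B (σ *ₚ τ) m → Expansion A B τ n → T m ≃ σ · T n
T-proportional {A} {B} σ τ m n (expand c p q) (expand c′ p′ q′) = begin
  D m *ₚ D (m + 2) *ₚ D (n + 1) ^ₚ 2
    ≈⟨ ℤ[x].*-cong p q′ ⟩
  σ *ₚ τ *ₚ (c *ₚ A) *ₚ (c′ *ₚ B)
    ≈⟨ solveₚ 6 (λ σ τ c A c′ B → σ :* τ :* (c :* A) :* (c′ :* B) :=
         σ :* (τ :* (c′ :* A)) :* (c :* B)) ≈-refl σ τ c A c′ B ⟩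
  σ *ₚ (τ *ₚ (c′ *ₚ A)) *ₚ (c *ₚ B)
    ≈⟨ ℤ[x].*-cong (ℤ[x].*-congˡ p′) q ⟨
  σ *ₚ (D n *ₚ D (n + 2)) *ₚ D (m + 1) ^ₚ 2 ∎

theorem5p6 : ∀ (k n : ℕ) (j : Fin 2) → 1 ≤ k →
    T (2 ^ (k + 1) * n + 2 ^ k ∸ 2 + toℕ j) ≃ (-ₚ 1ₚ) ^ₚ n · T (2 ^ k ∸ 2 + toℕ j)
-- Relative to `T q` the two signs have exponents n + j and j, which leaves `ε ^ₚ n`.
theorem5p6 k n j 1≤k = T-proportional (ε ^ₚ n) (ε ^ₚ toℕ j) _ _
  (Expansion-resp k q q+2≡2^k (^-homo-* ε n (toℕ j)) index≡ (expansion k q q+2≡2^k n j))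
  (Expansion-base k q q+2≡2^k j)
  where
  q = 2 ^ k ∸ 2

  -- The hypothesis on `k` makes the truncated subtraction of 2 exact.
  2≤2^k : 2 ≤ 2 ^ k
  2≤2^k = ℕₚ.^-monoʳ-≤ 2 1≤k

  q+2≡2^k : q + 2 ≡ 2 ^ k
  q+2≡2^k = ℕₚ.m∸n+n≡m 2≤2^k

  index≡ : 2 ^ (k + 1) * n + (q + toℕ j) ≡ 2 ^ (k + 1) * n + 2 ^ k ∸ 2 + toℕ j
  index≡ = ≡.trans (≡.sym (ℕₚ.+-assoc (2 ^ (k + 1) * n) q (toℕ j)))
    (cong (_+ toℕ j) (≡.sym (ℕₚ.+-∸-assoc (2 ^ (k + 1) * n) 2≤2^k)))
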